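{- Let $\mathcal{C}$ be a class of ontologies. If $\textsc{cert-eval}[\mathcal{C}]$ is decidable, then $\textsc{dp-cert-eval}[\mathcal{C}]$ is decidable.
   Context: Standard setting: atoms, databases, TGDs $\sigma:\Phi(\mathbf{x},\mathbf{y})\to\exists\mathbf{z}\,\Psi(\mathbf{x},\mathbf{z})$, ontologies (finite sets of TGDs), datalog rules (no existential variables, single head atom), CQs, certain answers $\mathrm{cert}(q,D,\Sigma)=\bigcap\{q(M):M\supseteq D \text{ model of }\Sigma\}$. $\textsc{cert-eval}[\mathcal{C}]$: given database $D$, $\Sigma\in\mathcal{C}$, CQ $q(\mathbf{x})$, constant tuple $\mathbf{c}$, decide $\mathbf{c}\in\mathrm{cert}(q,D,\Sigma)$. For existential variable $z$, a position $\pi$ is $z$-affected if some rule has $z$ in its head at $\pi$, or some rule has a frontier variable in its head at $\pi$ occurring in its body only at $z$-affected positions; $\mathrm{aff}(\pi)$ is the set of such $z$; a body variable at positions $\pi_1,\dots,\pi_n$ is harmless if $\bigcap_i\mathrm{aff}(\pi_i)=\emptyset$. $\Sigma'\subseteq\Sigma$ is head-ground w.r.t. $\Sigma$ if (1) it consists of datalog rules; (2) its head atoms contain only variables harmless w.r.t. $\Sigma$; (3) no head predicate of $\Sigma'$ occurs in a body of $\Sigma'$; (4) no head predicate of $\Sigma'$ occurs in a head of $\Sigma\setminus\Sigma'$. A pair $\Pi=(\Sigma_{hg},\Sigma_{\mathcal{C}})$ is $\mathcal{C}$-dyadic if $\Sigma_{hg}$ is head-ground w.r.t. $\Sigma_{hg}\cup\Sigma_{\mathcal{C}}$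 and $\Sigma_{\mathcal{C}}\in\mathcal{C}$. $\textsc{dp-cert-eval}[\mathcal{C}]$: given a database $D$, a $\mathcal{C}$-dyadic pair $\Pi=(\Sigma_{hg},\Sigma_{\mathcal{C}})$, a CQ $q(\mathbf{x})$ and $\mathbf{c}\in\mathsf{C}^{|\mathbf{x}|}$, decide whether $\mathbf{c}\in\mathrm{cert}(q,D,\Sigma_{hg}\cup\Sigma_{\mathcal{C}})$. -}

module Defs where

open import Level using (Level; 0ℓ; _⊔_) renaming (suc to lsuc)
open import Data.Nat using (ℕ)
open import Data.Fin using (Fin)
open import Data.Vec as Vec using (Vec; lookup)
open import Data.Vec.Relation.Unary.All as VecAll using ()
open import Data.List using (List; _++_; length)
open import Data.List.Relation.Unary.All using (All)
open import Data.List.Membership.Propositional using (_∈_; _∉_)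
open import Data.List.Relation.Binary.Subset.Propositional using (_⊆_)
open import Data.Product using (Σ; ∃-syntax; _×_; _,_)
open import Relation.Binary.PropositionalEquality using (_≡_; _≢_)
open import Relation.Nullary using (¬_; Dec)
open import Relation.Unary using (Pred)

private
  variable
    ℓ p q : Level
    n : ℕ

Const Null Var : Set
Const = ℕ
Null  = ℕ
Var   = ℕ

-- Terms of rules and queries.
data Term : Set where
  con : Const → Term
  var : Var → Term

-- Terms of instances.
data Value : Set where
  con  : Const → Value
  null : Null → Value

record Predicate : Set where
  constructor mkPredicate
  field
    name  : ℕ
    arity : ℕ
open Predicate public

record Atom (T : Set) : Set where
  constructor mkAtom
  field
    pred : Predicate
    args : Vec T (arity pred)
open Atom public

mapAtom : {S T : Set} → (S → T) → Atom S → Atom T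
mapAtom f (mkAtom P ts) = mkAtom P (Vec.map f ts)

Database : Set
Database = List (Atom Const)

-- A possibly infinite set of atoms over constants and nulls.
Instance : Set₁
Instance = Pred (Atom Value) 0ℓ

_⊇ᴰ_ : Instance → Database → Set
M ⊇ᴰ D = All (λ a → M (mapAtom con a)) D

Assignment : Set
Assignment = Var → Value

apply : Assignment → Term → Value
apply h (con c) = con c
apply h (var x) = h x

_⊢_↦_ : Assignment → List (Atom Term) → Instance → Set
h ⊢ Φ ↦ M = All (λ a → M (mapAtom (apply h) a)) Φ

Position : Set
Position = Σ Predicate (λ P → Fin (arity P))

_OccursAt_In_ : Var → Position → List (Atom Term) → Set
x OccursAt π In Φ =
  ∃[ a ] a ∈ Φ × ∃[ i ] (pred a , i) ≡ π × lookup (args a) i ≡ var x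

_OccursIn_ : Var → List (Atom Term) → Set
x OccursIn Φ = ∃[ π ] x OccursAt π In Φ

-- The quantifier prefix of Φ(x,y) → ∃z Ψ(x,z) is left implicit: x are the
-- variables shared by body and head, y those only in the body, and z those
-- only in the head.
record TGD : Set where
  constructor mkTGD
  field
    body : List (Atom Term)
    head : List (Atom Term)
open TGD public

Frontier Existential : TGD → Pred Var 0ℓ
Frontier    σ x = x OccursIn body σ × x OccursIn head σ
Existential σ z = z OccursIn head σ × ¬ (z OccursIn body σ)

-- Finite sets of TGDs are represented by lists.
Ontology : Set
Ontology = List TGD

_⊨_ : Instance → TGD → Set
M ⊨ σ = ∀ h → h ⊢ body σ ↦ M →
        ∃[ h′ ] (∀ x → Frontier σ x → h′ x ≡ h x) × h′ ⊢ head σ ↦ M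

Model : Ontology → Pred Instance 0ℓ
Model O M = All (M ⊨_) O

record CQ (n : ℕ) : Set where
  constructor mkCQ
  field
    output : Vec Var n
    conj   : List (Atom Term)
    safe   : VecAll.All (_OccursIn conj) output
open CQ public

answers : CQ n → Instance → Pred (Vec Value n) 0ℓ
answers q M t = ∃[ h ] h ⊢ conj q ↦ M × Vec.map h (output q) ≡ t

cert : CQ n → Database → Ontology → Pred (Vec Const n) (lsuc 0ℓ)
cert q D O c = ∀ M → M ⊇ᴰ D → Model O M → answers q M (Vec.map con c)

-- Existential variables of different rules count as different, whatever
-- their names, so an existential variable is given by its rule σ and its
-- name z.
data Affected (O : Ontology) (σ : TGD) (z : Var) (π : Position) : Set where
  created    : σ ∈ O → Existential σ z → z OccursAt π In head σ →
               Affected O σ z π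
  propagated : ∀ {ρ x} → ρ ∈ O → Frontier ρ x → x OccursAt π In head ρ →
               (∀ π′ → x OccursAt π′ In body ρ → Affected O σ z π′) →
               Affected O σ z π

-- The body variable x of ρ is harmless w.r.t. O. As x occurs in the body,
-- a pair (σ , z) refuting the second component is necessarily an existential
-- variable of a rule of O.
Harmless : Ontology → TGD → Pred Var 0ℓ
Harmless O ρ x =
  x OccursIn body ρ ×
  ¬ (∃[ σ ] ∃[ z ] ∀ π → x OccursAt π In body ρ → Affected O σ z π)

record Datalog (σ : TGD) : Set where
  field
    no-existential : ∀ z → ¬ Existential σ z
    single-head    : length (head σ) ≡ 1

record HeadGround (O′ O : Ontology) : Set where
  field
    subset        : O′ ⊆ O
    datalog       : ∀ {σ} → σ ∈ O′ → Datalog σ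
    harmless      : ∀ {σ x} → σ ∈ O′ → x OccursIn head σ → Harmless O σ x
    not-in-bodies : ∀ {σ τ a b} → σ ∈ O′ → a ∈ head σ →
                    τ ∈ O′ → b ∈ body τ → pred a ≢ pred b
    not-in-heads  : ∀ {σ τ a b} → σ ∈ O′ → a ∈ head σ →
                    τ ∈ O → τ ∉ O′ → b ∈ head τ → pred a ≢ pred b

record Dyadic (C : Pred Ontology ℓ) (Oʰᵍ Oᶜ : Ontology) : Set ℓ where
  field
    head-ground : HeadGround Oʰᵍ (Oʰᵍ ++ Oᶜ)
    in-class    : C Oᶜ

record DecisionProblem p q : Set (lsuc (p ⊔ q)) where
  field
    Input   : Set
    Promise : Pred Input p
    Yes     : Pred Input q

-- The promise is irrelevant: a decision procedure receives only the input
-- and cannot inspect the reason why the promise holds.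
Decidable : DecisionProblem p q → Set (p ⊔ q)
Decidable 𝒫 = ∀ i → .(Promise i) → Dec (Yes i)
  where open DecisionProblem 𝒫

record CertEvalInput : Set where
  field
    database : Database
    ontology : Ontology
    {arityᵠ} : ℕ
    query    : CQ arityᵠ
    tuple    : Vec Const arityᵠ

CERT-EVAL : Pred Ontology ℓ → DecisionProblem ℓ (lsuc 0ℓ)
CERT-EVAL C = record
  { Input   = CertEvalInput
  ; Promise = λ i → let open CertEvalInput i in C ontology
  ; Yes     = λ i → let open CertEvalInput i in
                    cert query database ontology tuple
  }

record DPCertEvalInput : Set where
  field
    database : Database
    Oʰᵍ Oᶜ   : Ontology
    {arityᵠ} : ℕ
    query    : CQ arityᵠ
    tuple    : Vec Const arityᵠ

DP-CERT-EVAL : Pred Ontology ℓ → DecisionProblem ℓ (lsuc 0ℓ)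
DP-CERT-EVAL C = record
  { Input   = DPCertEvalInput
  ; Promise = λ i → let open DPCertEvalInput i in Dyadic C Oʰᵍ Oᶜ
  ; Yes     = λ i → let open DPCertEvalInput i in
                    cert query database (Oʰᵍ ++ Oᶜ) tuple
  }

{-# OPTIONS --safe #-}
module Submission where

-- Harmless variables can only be bound to constants in the chase, so only finitely many
-- ground instances of the heads of Σ_hg are relevant. Adding such an instance to the
-- database as soon as the oracle declares the body certain w.r.t. Σ_C, until nothing new
-- can be added, gives a database D* entailed by D and Σ_hg ∪ Σ_C. The Skolem chase of D*
-- under Σ_C is then a model of Σ_hg as well: if a body holds in the chase then, the chase
-- being universal, the instance of the body query is certain, so its head lies in D*.
-- Hence the certain answers over (D, Σ_hg ∪ Σ_C) are those over (D*, Σ_C).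

open import Level using (Level)
open import Data.Fin using (Fin; zero; suc; toℕ)
open import Data.Fin.Properties using (toℕ-injective)
open import Data.List as List
  using (List; []; _∷_; _++_; [_]; concatMap; cartesianProductWith; filter; length)
open import Data.List.Membership.Propositional using (_∈_; _∉_; find)
open import Data.List.Membership.Propositional.Properties
  using (∈-concatMap⁺; ∈-concatMap⁻; ∈-++⁺ˡ; ∈-++⁺ʳ; ∈-++⁻; ∈-map⁺; ∈-map⁻; ∈-lookup;
         ∈-cartesianProductWith⁺; ∈-cartesianProductWith⁻; ∈-filter⁺; ∈-filter⁻)
open import Data.List.Properties using (∷-injective)
open import Data.List.Relation.Binary.Subset.Propositional using (_⊆_)
open import Data.List.Relation.Unary.All as All using (All; []; _∷_)
import Data.List.Relation.Unary.All.Properties as AllP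
import Data.List.Relation.Unary.Any.Properties as AnyP
open import Data.List.Relation.Unary.Any as Any using (here; there; index)
open import Data.Nat using (ℕ; zero; suc; _+_; _≟_)
open import Data.Nat.Properties using (+-suc; +-identityʳ; suc-injective)
open import Data.List.Membership.DecPropositional _≟_ using (_∈?_)
open import Data.Product using (∃-syntax; _×_; _,_; proj₁; proj₂)
open import Data.Product.Properties using (,-injective)
import Data.Sum as Sum
open import Data.Vec as Vec using (Vec; []; _∷_; lookup; toList; fromList)
open import Data.Vec.Properties as VecP using (lookup-map; map-∘)
import Data.Vec.Membership.Propositional.Properties as VecMem
import Data.Vec.Relation.Unary.All.Properties as VecAllP
open import Function using (_∘_; id)
open import Relation.Binary.PropositionalEquality
  using (_≡_; refl; sym; trans; cong; cong₂; subst)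
open import Relation.Nullary using (Dec; yes; no; contradiction)
open import Relation.Nullary.Decidable using (_×-dec_; map′; recompute)
open import Relation.Unary using (Pred)
open import Defs

-- Injective codes for triggers

-- One step of Cantor's walk: along an antidiagonal from `(0 , s)` to `(s , 0)`, then on to
-- `(0 , s + 1)`.
next : ℕ × ℕ → ℕ × ℕ
next (m , zero)  = zero , suc m
next (m , suc n) = suc m , n

unpair : ℕ → ℕ × ℕ
unpair zero    = zero , zero
unpair (suc k) = next (unpair k)

-- The walk is traced backwards: within an antidiagonal `m` decreases, and moving to the previous
-- one decreases `s`, so the recursion is lexicographic in `s` and `m`.
unpair-surjective : ∀ s m n → m + n ≡ s → ∃[ k ] unpair k ≡ (m , n)
unpair-surjective s       (suc m) n       e
  with k , eq ← unpair-surjective s m (suc n) (trans (+-suc m n) e) = suc k , cong next eq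
unpair-surjective (suc s) zero    (suc n) e
  with k , eq ← unpair-surjective s n zero (trans (+-identityʳ n) (suc-injective e)) = suc k , cong next eq
unpair-surjective s       zero    zero    e = zero , refl

abstract
  pair : ℕ → ℕ → ℕ
  pair m n = proj₁ (unpair-surjective (m + n) m n refl)

  unpair-pair : ∀ m n → unpair (pair m n) ≡ (m , n)
  unpair-pair m n = proj₂ (unpair-surjective (m + n) m n refl)

pair-injective : ∀ {m n m′ n′} → pair m n ≡ pair m′ n′ → m ≡ m′ × n ≡ n′
pair-injective {m} {n} {m′} {n′} e =
  ,-injective (trans (sym (unpair-pair m n)) (trans (cong unpair e) (unpair-pair m′ n′)))

encode : Value → ℕ
encode (con c)  = pair 0 c
encode (null n) = pair 1 n

encode-injective : ∀ {v w} → encode v ≡ encode w → v ≡ w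
encode-injective {con c}  {con d}  e = cong con (proj₂ (pair-injective e))
encode-injective {con c}  {null n} e = contradiction (proj₁ (pair-injective e)) λ ()
encode-injective {null m} {con d}  e = contradiction (proj₁ (pair-injective e)) λ ()
encode-injective {null m} {null n} e = cong null (proj₂ (pair-injective e))

encodeList : List Value → ℕ
encodeList []       = zero
encodeList (v ∷ vs) = suc (pair (encode v) (encodeList vs))

encodeList-injective : ∀ {vs ws} → encodeList vs ≡ encodeList ws → vs ≡ ws
encodeList-injective {[]}     {[]}     e = refl
encodeList-injective {v ∷ vs} {w ∷ ws} e with pair-injective (suc-injective e)
... | e₁ , e₂ = cong₂ _∷_ (encode-injective e₁) (encodeList-injective e₂)

map-injective-∈ : ∀ {A B : Set} {f g : A → B} {xs x} →
                  List.map f xs ≡ List.map g xs → x ∈ xs → f x ≡ g x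
map-injective-∈ e (here refl) = proj₁ (∷-injective e)
map-injective-∈ e (there x∈)  = map-injective-∈ (proj₂ (∷-injective e)) x∈

-- Atoms, variables and constants

mapAtom-cong : ∀ {S T : Set} {f g : S → T} (a : Atom S) →
               (∀ i → f (lookup (args a) i) ≡ g (lookup (args a) i)) →
               mapAtom f a ≡ mapAtom g a
mapAtom-cong {f = f} {g} (mkAtom P ts) e = cong (mkAtom P) (go ts e)
  where
  go : ∀ {n} (ts : Vec _ n) → (∀ i → f (lookup ts i) ≡ g (lookup ts i)) →
       Vec.map f ts ≡ Vec.map g ts
  go []       e = refl
  go (t ∷ ts) e = cong₂ _∷_ (e zero) (go ts (e ∘ suc))

mapAtom-∘ : ∀ {S T U : Set} (f : T → U) (g : S → T) (a : Atom S) →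
            mapAtom f (mapAtom g a) ≡ mapAtom (f ∘ g) a
mapAtom-∘ f g (mkAtom P ts) = cong (mkAtom P) (sym (map-∘ f g ts))

lookup-mapAtom : ∀ {S T : Set} (f : S → T) (a : Atom S) i {t} → lookup (args a) i ≡ t →
                 lookup (args (mapAtom f a)) i ≡ f t
lookup-mapAtom f a i e = trans (lookup-map i f (args a)) (cong f e)

collect : ∀ {T : Set} → (T → List ℕ) → List (Atom T) → List ℕ
collect f = concatMap (λ a → concatMap f (toList (args a)))

module _ {T : Set} (f : T → List ℕ) {x : ℕ} where

  ∈-collect⁺ : ∀ {Φ a} → a ∈ Φ → ∀ i → x ∈ f (lookup (args a) i) → x ∈ collect f Φ
  ∈-collect⁺ {Φ} {a} a∈Φ i x∈ = ∈-concatMap⁺ _ (Any.map (λ { refl → in-atom }) a∈Φ)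
    where
    in-atom : x ∈ concatMap f (toList (args a))
    in-atom = ∈-concatMap⁺ f
      (Any.map (λ { refl → x∈ }) (VecMem.∈-toList⁺ (VecMem.∈-lookup i (args a))))

  ∈-collect⁻ : ∀ {Φ} → x ∈ collect f Φ → ∃[ a ] a ∈ Φ × ∃[ i ] x ∈ f (lookup (args a) i)
  ∈-collect⁻ {Φ} x∈ with a , a∈Φ , x∈a ← find (∈-concatMap⁻ _ {xs = Φ} x∈) =
    a , a∈Φ , go (args a) (∈-concatMap⁻ f x∈a)
    where
    go : ∀ {n} (ts : Vec T n) → Any.Any (λ t → x ∈ f t) (toList ts) → ∃[ i ] x ∈ f (lookup ts i)
    go (t ∷ ts) (here p)  = zero , p
    go (t ∷ ts) (there p) with i , q ← go ts p = suc i , q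

termVars termConsts : Term → List ℕ
termVars (con _)   = []
termVars (var x)   = [ x ]
termConsts (con c) = [ c ]
termConsts (var _) = []

vars : List (Atom Term) → List Var
vars = collect termVars

∈-vars⁺ : ∀ {x a Φ} → a ∈ Φ → ∀ i → lookup (args a) i ≡ var x → x ∈ vars Φ
∈-vars⁺ {x} a∈Φ i e = ∈-collect⁺ termVars a∈Φ i (subst (λ t → x ∈ termVars t) (sym e) (here refl))

occurs⇒∈-vars : ∀ {x Φ} → x OccursIn Φ → x ∈ vars Φ
occurs⇒∈-vars (_ , _ , a∈Φ , i , _ , e) = ∈-vars⁺ a∈Φ i e

∈-vars⇒occurs : ∀ {x} Φ → x ∈ vars Φ → x OccursIn Φ
∈-vars⇒occurs {x} Φ x∈ with ∈-collect⁻ termVars {Φ = Φ} x∈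
... | a , a∈Φ , i , x∈t = (pred a , i) , a , a∈Φ , i , refl , var≡ _ x∈t
  where
  var≡ : ∀ t → x ∈ termVars t → t ≡ var x
  var≡ (var _) (here refl) = refl

term-cong : ∀ {A : Set} (f g : Term → A) t → (∀ c → f (con c) ≡ g (con c)) →
            (∀ x → t ≡ var x → f (var x) ≡ g (var x)) → f t ≡ g t
term-cong f g (con c) ec ev = ec c
term-cong f g (var x) ec ev = ev x refl

mapAtom-vars-cong : ∀ {A : Set} {f g : Term → A} {Φ a} → (∀ c → f (con c) ≡ g (con c)) →
                    (∀ {x} → x ∈ vars Φ → f (var x) ≡ g (var x)) →
                    a ∈ Φ → mapAtom f a ≡ mapAtom g a
mapAtom-vars-cong {f = f} {g} {a = a} ec ev a∈Φ =
  mapAtom-cong a λ i → term-cong f g (lookup (args a) i) ec λ x e → ev (∈-vars⁺ a∈Φ i e)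

-- The Skolem chase

-- The null invented for `x` codes the pair of trigger and variable, so that `unpair` recovers from
-- a null which trigger created it and for which variable.
skolem : ℕ → List (Atom Term) → Assignment → Assignment
skolem t Φ h x with x ∈? vars Φ
... | yes _ = h x
... | no  _ = null (pair t x)

skolem-∈ : ∀ t Φ h {x} → x ∈ vars Φ → skolem t Φ h x ≡ h x
skolem-∈ t Φ h {x} x∈ with x ∈? vars Φ
... | yes _  = refl
... | no  x∉ = contradiction x∈ x∉

mapValue : (Null → Value) → Value → Value
mapValue g (con c)  = con c
mapValue g (null n) = g n

mapValue-apply : ∀ g h t → mapValue g (apply h t) ≡ apply (mapValue g ∘ h) t
mapValue-apply g h (con c) = refl
mapValue-apply g h (var x) = refl

mapAtom-apply : ∀ g h a →
                mapAtom (mapValue g) (mapAtom (apply h) a) ≡ mapAtom (apply (mapValue g ∘ h)) a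
mapAtom-apply g h a = trans (mapAtom-∘ (mapValue g) (apply h) a)
  (mapAtom-cong a λ i → mapValue-apply g h (lookup (args a) i))

rule : (O : Ontology) → Fin (length O) → TGD
rule = List.lookup

-- All body variables count, not only the frontier, as in the oblivious chase. The code fixes the
-- index of the rule and the values of `h` on its body, hence all of `fired O i h`.
trigger : (O : Ontology) → Fin (length O) → Assignment → ℕ
trigger O i h = pair (toℕ i) (encodeList (List.map h (vars (body (rule O i)))))

fired : (O : Ontology) → Fin (length O) → Assignment → Assignment
fired O i h = skolem (trigger O i h) (body (rule O i)) h

data Chase (D : Database) (O : Ontology) : Instance where
  fact : ∀ {a} → a ∈ D → Chase D O (mapAtom con a)
  fire : ∀ i h {a} → h ⊢ body (rule O i) ↦ Chase D O → a ∈ head (rule O i) →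
         Chase D O (mapAtom (apply (fired O i h)) a)

module _ {D : Database} {O : Ontology} where

  module _ {ℓ} {P : Pred (Atom Value) ℓ}
           (P-fact : ∀ {a} → a ∈ D → P (mapAtom con a))
           (P-fire : ∀ i h → All (P ∘ mapAtom (apply h)) (body (rule O i)) →
                     ∀ {a} → a ∈ head (rule O i) → P (mapAtom (apply (fired O i h)) a))
           where

    chase-induction  : ∀ {a} → Chase D O a → P a
    chase-inductions : ∀ {h Φ} → h ⊢ Φ ↦ Chase D O → All (P ∘ mapAtom (apply h)) Φ

    chase-induction (fact a∈D)       = P-fact a∈D
    chase-induction (fire i h bs a∈) = P-fire i h (chase-inductions bs) a∈

    chase-inductions []       = []
    chase-inductions (b ∷ bs) = chase-induction b ∷ chase-inductions bs

  chase-model : Model O (Chase D O)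
  chase-model = All.tabulate λ σ∈O →
    subst (Chase D O ⊨_) (sym (AnyP.lookup-index σ∈O)) (rule-sat (index σ∈O))
    where
    rule-sat : ∀ i → Chase D O ⊨ rule O i
    rule-sat i h bs =
      fired O i h ,
      (λ x (x∈b , _) → skolem-∈ (trigger O i h) (body (rule O i)) h (occurs⇒∈-vars x∈b)) ,
      All.tabulate (fire i h bs)

  -- The chase maps into M only one finite piece at a time: M ⊨ σ yields witnesses
  -- that may depend on the proof that the body holds, so a homomorphism must remember
  -- which triggers have been fired already and reuse their witnesses.
  module _ {M : Instance} (M⊇D : M ⊇ᴰ D) (M⊨O : Model O M) where

    Owned : List ℕ → Null → Set
    Owned F n = proj₁ (unpair n) ∈ F

    -- Owning every null of the atom pins its image down: later stages extend the map only at nulls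
    -- not yet owned.
    Embedded : (Null → Value) → List ℕ → Atom Value → Set
    Embedded g F a = (∀ j {n} → lookup (args a) j ≡ null n → Owned F n) × M (mapAtom (mapValue g) a)

    record PartialHom : Set where
      field
        witness : Null → Value
        done    : List ℕ
        correct : ∀ i h → trigger O i h ∈ done →
                  All (Embedded witness done ∘ mapAtom (apply (fired O i h))) (head (rule O i))
    open PartialHom

    record _≼_ (s s′ : PartialHom) : Set where
      field
        done-⊆ : done s ⊆ done s′
        agree  : ∀ {n} → Owned (done s) n → witness s′ n ≡ witness s n
    open _≼_

    ≼-refl : ∀ {s} → s ≼ s
    ≼-refl = record { done-⊆ = id ; agree = λ _ → refl }

    ≼-trans : ∀ {s s′ s″} → s ≼ s′ → s′ ≼ s″ → s ≼ s″
    ≼-trans p q = record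
      { done-⊆ = done-⊆ q ∘ done-⊆ p
      ; agree  = λ o → trans (agree q (done-⊆ p o)) (agree p o)
      }

    -- The image of an embedded atom depends only on owned nulls, where both maps agree. Bare maps
    -- and lists appear here because the next `PartialHom` is itself built with this lemma.
    embedded-mono : ∀ {g g′ F F′} → F ⊆ F′ → (∀ {n} → Owned F n → g′ n ≡ g n) →
                    ∀ {a} → Embedded g F a → Embedded g′ F′ a
    embedded-mono {g} {g′} F⊆F′ g′≡g {a} (owned , m) =
      (λ j e → F⊆F′ (owned j e)) ,
      subst M (mapAtom-cong a λ j → mapValue-≡ (lookup (args a) j) (owned j)) m
      where
      mapValue-≡ : ∀ v → (∀ {n} → v ≡ null n → Owned _ n) → mapValue g v ≡ mapValue g′ v
      mapValue-≡ (con c)  o = refl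
      mapValue-≡ (null n) o = sym (g′≡g (o refl))

    -- Quantifying over the starting stage lets the atoms of a body be embedded one after the other,
    -- each from the stage left by the previous one.
    Embeddable : Atom Value → Set
    Embeddable a = ∀ s → ∃[ s′ ] s ≼ s′ × Embedded (witness s′) (done s′) a

    embed-all : ∀ {A : Set} {f : A → Atom Value} {as} → All (Embeddable ∘ f) as → ∀ s →
                ∃[ s′ ] s ≼ s′ × All (Embedded (witness s′) (done s′) ∘ f) as
    embed-all []       s = s , ≼-refl , []
    embed-all (p ∷ ps) s with s₁ , s≼s₁ , e ← p s with s₂ , s₁≼s₂ , es ← embed-all ps s₁ =
      s₂ , ≼-trans s≼s₁ s₁≼s₂ , embedded-mono (done-⊆ s₁≼s₂) (agree s₁≼s₂) e ∷ es

    module Fire (i : Fin (length O)) (h : Assignment) (s : PartialHom)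
                (bs : All (Embedded (witness s) (done s) ∘ mapAtom (apply h)) (body (rule O i)))
                (new : trigger O i h ∉ done s) where

      t : ℕ
      t = trigger O i h

      g : Null → Value
      g = witness s

      body-in-M : (mapValue g ∘ h) ⊢ body (rule O i) ↦ M
      body-in-M = All.map (λ { {b} (_ , m) → subst M (mapAtom-apply g h b) m }) bs

      sat = All.lookup M⊨O (∈-lookup i) (mapValue g ∘ h) body-in-M

      h′ : Assignment
      h′ = proj₁ sat

      -- Only nulls of the trigger `t` are redefined; as `t` is new, none of them is owned yet.
      g′ : Null → Value
      g′ n with proj₁ (unpair n) ≟ t
      ... | yes _ = h′ (proj₂ (unpair n))
      ... | no  _ = g n

      g′-old : ∀ {n} → Owned (done s) n → g′ n ≡ g n
      g′-old {n} o with proj₁ (unpair n) ≟ t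
      ... | yes e = contradiction (subst (_∈ done s) e o) new
      ... | no  _ = refl

      g′-new : ∀ x → g′ (pair t x) ≡ h′ x
      g′-new x with proj₁ (unpair (pair t x)) ≟ t
      ... | yes _ = cong (h′ ∘ proj₂) (unpair-pair t x)
      ... | no ¬e = contradiction (cong proj₁ (unpair-pair t x)) ¬e

      owned-body : ∀ {x n} → x ∈ vars (body (rule O i)) → h x ≡ null n → Owned (done s) n
      owned-body x∈ e with _ , b , b∈ , j , _ , ej ← ∈-vars⇒occurs (body (rule O i)) x∈ =
        proj₁ (All.lookup bs b∈) j
          (trans (lookup-mapAtom (apply h) b j ej) e)

      mapValue-old : ∀ {x} → x ∈ vars (body (rule O i)) → mapValue g′ (h x) ≡ mapValue g (h x)
      mapValue-old {x} x∈ with h x in e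
      ... | con c  = refl
      ... | null n = g′-old (owned-body x∈ e)

      -- Existential variables became nulls of `t`, which `g′` sends to `h′` by design. On frontier
      -- variables `h′` agrees with the image of `h` under `g`, which `g′` leaves unchanged.
      fired-h′ : ∀ {x} → x ∈ vars (head (rule O i)) → mapValue g′ (fired O i h x) ≡ h′ x
      fired-h′ {x} x∈head with x ∈? vars (body (rule O i))
      ... | no  _  = g′-new x
      ... | yes x∈ = trans (mapValue-old x∈)
        (sym (proj₁ (proj₂ sat) x (∈-vars⇒occurs _ x∈ , ∈-vars⇒occurs _ x∈head)))

      fired-owned : ∀ {x n} → fired O i h x ≡ null n → Owned (t ∷ done s) n
      fired-owned {x} e with x ∈? vars (body (rule O i))
      fired-owned e    | yes x∈ = there (owned-body x∈ e)
      fired-owned refl | no  _  = here (cong proj₁ (unpair-pair t _))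

      term-owned : ∀ u {n} → apply (fired O i h) u ≡ null n → Owned (t ∷ done s) n
      term-owned (var x) e = fired-owned e

      head-embedded : All (Embedded g′ (t ∷ done s) ∘ mapAtom (apply (fired O i h))) (head (rule O i))
      head-embedded = All.tabulate λ {a} a∈ →
        (λ j e → term-owned (lookup (args a) j) (trans (sym (lookup-map j _ (args a))) e)) ,
        subst M (sym (trans (mapAtom-∘ (mapValue g′) (apply (fired O i h)) a)
                            (mapAtom-vars-cong (λ _ → refl) fired-h′ a∈)))
                (All.lookup (proj₂ (proj₂ sat)) a∈)

      -- `correct` speaks of every assignment with the code `t`. Equal codes mean equal rules and
      -- equal values on the body, so both assignments produce the same head atoms.
      same-trigger : ∀ {k h₂} → trigger O k h₂ ≡ t →
                     All (Embedded g′ (t ∷ done s) ∘ mapAtom (apply (fired O k h₂))) (head (rule O k))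
      same-trigger {k} {h₂} e with toℕ-injective (proj₁ (pair-injective e))
      ... | refl = All.tabulate λ {a} a∈ →
        subst (Embedded g′ (t ∷ done s))
              (mapAtom-vars-cong (λ _ → refl) (λ {x} _ → fired-≡ x) a∈)
              (All.lookup head-embedded a∈)
        where
        fired-≡ : ∀ x → fired O i h x ≡ fired O i h₂ x
        fired-≡ x with x ∈? vars (body (rule O i))
        ... | yes x∈ = sym (map-injective-∈ (encodeList-injective (proj₂ (pair-injective e))) x∈)
        ... | no  _  = cong (λ t → null (pair t x)) (sym e)

      s′ : PartialHom
      s′ = record
        { witness = g′
        ; done    = t ∷ done s
        ; correct = λ
          { k h₂ (here e)  → same-trigger e
          ; k h₂ (there m) → All.map (embedded-mono there g′-old) (correct s k h₂ m)
          }
        }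

      s≼s′ : s ≼ s′
      s≼s′ = record { done-⊆ = there ; agree = g′-old }

    embed : ∀ {a} → Chase D O a → Embeddable a
    embed = chase-induction embed-fact embed-fire
      where
      embed-fact : ∀ {a} → a ∈ D → Embeddable (mapAtom con a)
      embed-fact {a} a∈D s = s , ≼-refl ,
        (λ j e → contradiction (trans (sym (lookup-map j con (args a))) e) λ ()) ,
        subst M (sym (mapAtom-∘ _ con a)) (All.lookup M⊇D a∈D)

      embed-fire : ∀ i h → All (Embeddable ∘ mapAtom (apply h)) (body (rule O i)) →
                   ∀ {a} → a ∈ head (rule O i) → Embeddable (mapAtom (apply (fired O i h)) a)
      embed-fire i h bs a∈ s with embed-all bs s
      ... | s₁ , s≼s₁ , bs₁ with trigger O i h ∈? done s₁
      ... | yes old = s₁ , s≼s₁ , All.lookup (correct s₁ i h old) a∈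
      ... | no  new = s′ , ≼-trans s≼s₁ s≼s′ , All.lookup head-embedded a∈
        where open Fire i h s₁ bs₁ new

    empty : PartialHom
    -- Nothing is owned yet, so the values of `witness` are arbitrary.
    empty = record { witness = null ; done = [] ; correct = λ _ _ () }

    chase-maps-into : ∀ {h} Φ → h ⊢ Φ ↦ Chase D O → ∃[ g ] (mapValue g ∘ h) ⊢ Φ ↦ M
    chase-maps-into {h} Φ bs with s , _ , es ← embed-all (All.map embed bs) empty =
      witness s , All.map (λ { {b} (_ , m) → subst M (mapAtom-apply (witness s) h b) m }) es

  -- A query is finite, so a partial homomorphism that covers its match suffices. It fixes constants
  -- and thus carries the match to one in `M` with the same tuple.
  chase-universal : ∀ {n} (q : CQ n) {c} → answers q (Chase D O) (Vec.map con c) → cert q D O c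
  chase-universal q {c} (h , bs , e) M M⊇D M⊨O
    with g , ms ← chase-maps-into {M = M} M⊇D M⊨O (conj q) bs =
    mapValue g ∘ h , ms ,
    trans (map-∘ (mapValue g) h (output q))
          (trans (cong (Vec.map (mapValue g)) e) (sym (map-∘ (mapValue g) con c)))

-- Nulls of the chase and affected positions

nth : Ontology → ℕ → TGD
nth []      _       = mkTGD [] []
nth (σ ∷ O) zero    = σ
nth (σ ∷ O) (suc k) = nth O k

nth-lookup : ∀ O i → nth O (toℕ i) ≡ rule O i
nth-lookup (σ ∷ O) zero    = refl
nth-lookup (σ ∷ O) (suc i) = nth-lookup O i

creator : Ontology → Null → TGD
creator O n = nth O (proj₁ (unpair (proj₁ (unpair n))))

creator-pair : ∀ O i h x → creator O (pair (trigger O i h) x) ≡ rule O i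
creator-pair O i h x
  rewrite unpair-pair (trigger O i h) x
        | unpair-pair (toℕ i) (encodeList (List.map h (vars (body (rule O i))))) = nth-lookup O i

variable-of : Null → Var
variable-of n = proj₂ (unpair n)

module _ {D : Database} {O O⁺ : Ontology} (O⊆O⁺ : O ⊆ O⁺) where

  NullsAffected : Atom Value → Set
  NullsAffected a = ∀ j {n} → lookup (args a) j ≡ null n →
                    Affected O⁺ (creator O n) (variable-of n) (pred a , j)

  -- A null enters at a position of its existential variable (`created`). When a frontier variable
  -- copies it, all body occurrences of that variable hold the same null and are affected by
  -- induction, so `propagated` applies.
  nulls-affected : ∀ {a} → Chase D O a → NullsAffected a
  nulls-affected = chase-induction {P = NullsAffected}
    (λ {a} _ j e → contradiction (trans (sym (lookup-map j con (args a))) e) λ ())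
    (λ i h bs {a} a∈ j {n} e → head-affected i h bs a∈ j (lookup (args a) j) refl
      (trans (sym (lookup-map j (apply (fired O i h)) (args a))) e))
    where
    head-affected : ∀ i h → All (NullsAffected ∘ mapAtom (apply h)) (body (rule O i)) →
                    ∀ {a} → a ∈ head (rule O i) → ∀ j u → lookup (args a) j ≡ u →
                    ∀ {n} → apply (fired O i h) u ≡ null n →
                    Affected O⁺ (creator O n) (variable-of n) (pred a , j)
    head-affected i h bs {a} a∈ j (var x) at {n} e with x ∈? vars (body (rule O i))
    ... | yes x∈ = propagated (O⊆O⁺ (∈-lookup i))
      (∈-vars⇒occurs _ x∈ , (_ , a , a∈ , j , refl , at)) (a , a∈ , j , refl , at)
      λ { _ (b , b∈ , k , refl , bt) →
            All.lookup bs b∈ k (trans (lookup-mapAtom (apply h) b k bt) e) }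
    head-affected i h bs {a} a∈ j (var x) at refl | no x∉
      rewrite creator-pair O i h x | cong proj₂ (unpair-pair (trigger O i h) x) =
      created (O⊆O⁺ (∈-lookup i)) ((_ , a , a∈ , j , refl , at) , x∉ ∘ occurs⇒∈-vars)
              (a , a∈ , j , refl , at)

  -- A null bound to `x` would stand at every body position of `x`, making all of them affected by
  -- the one existential variable that created it.
  harmless-constant : ∀ ρ {h x} → h ⊢ body ρ ↦ Chase D O → Harmless O⁺ ρ x → ∃[ c ] h x ≡ con c
  harmless-constant ρ {h} {x} bs (_ , unaffected) with h x in e
  ... | con c  = c , refl
  ... | null n = contradiction
    (creator O n , variable-of n , λ { _ (b , b∈ , k , refl , bt) →
       nulls-affected (All.lookup bs b∈) k
         (trans (lookup-mapAtom (apply h) b k bt) e) })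
    unaffected

-- Constants of the chase

Within : List Const → Database → Set
Within K D = ∀ {a} → a ∈ D → ∀ j → lookup (args a) j ∈ K

HeadConstantsWithin : List Const → Ontology → Set
HeadConstantsWithin K O = ∀ {σ a} → σ ∈ O → a ∈ head σ → ∀ j {c} → lookup (args a) j ≡ con c → c ∈ K

module _ {K : List Const} {D : Database} {O : Ontology}
         (D⊆K : Within K D) (O⊆K : HeadConstantsWithin K O) where

  ConstantsIn : Atom Value → Set
  ConstantsIn a = ∀ j {c} → lookup (args a) j ≡ con c → c ∈ K

  chase-constants : ∀ {a} → Chase D O a → ConstantsIn a
  chase-constants = chase-induction {P = ConstantsIn}
    (λ {a} a∈ j e → con-∈ (D⊆K a∈ j) (trans (sym (lookup-map j con (args a))) e))
    (λ i h bs {a} a∈ j e → head-constants i h bs a∈ j (lookup (args a) j) refl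
      (trans (sym (lookup-map j (apply (fired O i h)) (args a))) e))
    where
    con-∈ : ∀ {c d} → c ∈ K → con c ≡ con d → d ∈ K
    con-∈ c∈K refl = c∈K

    head-constants : ∀ i h → All (ConstantsIn ∘ mapAtom (apply h)) (body (rule O i)) →
                     ∀ {a} → a ∈ head (rule O i) → ∀ j u → lookup (args a) j ≡ u →
                     ∀ {c} → apply (fired O i h) u ≡ con c → c ∈ K
    head-constants i h bs a∈ j (con c) at refl = O⊆K (∈-lookup i) a∈ j at
    head-constants i h bs a∈ j (var x) at e with x ∈? vars (body (rule O i))
    ... | yes x∈ with _ , b , b∈ , k , _ , bt ← ∈-vars⇒occurs (body (rule O i)) x∈ =
      All.lookup bs b∈ k (trans (lookup-mapAtom (apply h) b k bt) e)

  body-constants : ∀ {h Φ x c} → h ⊢ Φ ↦ Chase D O → x OccursIn Φ → h x ≡ con c → c ∈ K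
  body-constants {h} bs (_ , b , b∈ , k , _ , bt) e =
    chase-constants (All.lookup bs b∈) k
      (trans (lookup-mapAtom (apply h) b k bt) e)

-- Saturation

module _ {A B : Set} {ℓ} {P : List B → A → Set ℓ} (P? : ∀ bs a → Dec (P bs a)) (f : A → List B) where

  -- Rejecting a only at the result of saturating with as makes the recursion structural
  -- and needs no monotonicity of P.
  saturate : List A → List B → List B
  saturate []       bs = bs
  saturate (a ∷ as) bs with P? (saturate as bs) a
  ... | yes _ = saturate as (f a ++ saturate as bs)
  ... | no  _ = saturate as bs

  saturate-induction : ∀ {ℓ′} {I : Pred (List B) ℓ′} as →
                       (∀ {a bs} → a ∈ as → P bs a → I bs → I (f a ++ bs)) →
                       ∀ {bs} → I bs → I (saturate as bs)
  saturate-induction []       step i = i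
  saturate-induction {I = I} (a ∷ as) step {bs} i with P? (saturate as bs) a
  ... | yes p = saturate-induction {I = I} as (step ∘ there) (step (here refl) p
                  (saturate-induction {I = I} as (step ∘ there) i))
  ... | no  _ = saturate-induction {I = I} as (step ∘ there) i

  saturate-⊇ : ∀ as {bs} → bs ⊆ saturate as bs
  saturate-⊇ as {bs} = saturate-induction {I = bs ⊆_} as (λ {a} _ _ bs⊆ → ∈-++⁺ʳ (f a) ∘ bs⊆) id

  -- Accepting `a` puts `f a` into the base of the run that follows, and runs only add. Rejecting
  -- `a` happens at the very list that is then returned, so there `P` fails.
  saturate-closed : ∀ as {a bs} → a ∈ as → P (saturate as bs) a → f a ⊆ saturate as bs
  saturate-closed (a ∷ as) {bs = bs} a∈ p with P? (saturate as bs) a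
  saturate-closed (a ∷ as) (here refl) p | yes _ = saturate-⊇ as ∘ ∈-++⁺ˡ
  saturate-closed (a ∷ as) (there a∈)  p | yes _ = saturate-closed as a∈ p
  saturate-closed (a ∷ as) (here refl) p | no ¬p = contradiction p ¬p
  saturate-closed (a ∷ as) (there a∈)  p | no _  = saturate-closed as a∈ p

-- Ground assignments and body queries

update : Var → Const → (Var → Const) → Var → Const
update x c θ y with y ≟ x
... | yes _ = c
... | no  _ = θ y

assignments : List Const → List Var → List (Var → Const)
-- Only the values on the listed variables matter; elsewhere the default is 0.
assignments K []       = [ (λ _ → 0) ]
assignments K (x ∷ xs) = cartesianProductWith (update x) K (assignments K xs)

assignments-complete : ∀ {K} (h : Assignment) xs → (∀ {x} → x ∈ xs → ∃[ c ] c ∈ K × h x ≡ con c) →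
                       ∃[ θ ] θ ∈ assignments K xs × (∀ {x} → x ∈ xs → h x ≡ con (θ x))
assignments-complete h []       _ = _ , here refl , λ ()
assignments-complete h (x ∷ xs) k
  with θ , θ∈ , eq ← assignments-complete h xs (k ∘ there) | c , c∈K , ec ← k (here refl) =
  update x c θ , ∈-cartesianProductWith⁺ (update x) c∈K θ∈ , correct
  where
  correct : ∀ {y} → y ∈ x ∷ xs → h y ≡ con (update x c θ y)
  correct {y} y∈ with y ≟ x | y∈
  ... | yes refl | _         = ec
  ... | no  y≢x  | here y≡x  = contradiction y≡x y≢x
  ... | no  _    | there y∈′ = eq y∈′

map-fromList-cong : ∀ {A B : Set} {f g : A → B} xs → (∀ {x} → x ∈ xs → f x ≡ g x) →
                    Vec.map f (fromList xs) ≡ Vec.map g (fromList xs)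
map-fromList-cong []       e = refl
map-fromList-cong (x ∷ xs) e = cong₂ _∷_ (e (here refl)) (map-fromList-cong xs (e ∘ there))

map-fromList-injective : ∀ {A B : Set} {f g : A → B} {xs x} →
                         Vec.map f (fromList xs) ≡ Vec.map g (fromList xs) → x ∈ xs → f x ≡ g x
map-fromList-injective e (here refl) = VecP.∷-injectiveˡ e
map-fromList-injective e (there x∈)  = map-fromList-injective (VecP.∷-injectiveʳ e) x∈

ground : (Var → Const) → Term → Const
ground θ (con c) = c
ground θ (var x) = θ x

frontierVars : TGD → List Var
frontierVars ρ = filter (_∈? vars (body ρ)) (vars (head ρ))

-- Its certain answers are the frontier values at which the body holds in every model. Filtering the
-- head variables makes the query safe for an arbitrary rule.
bodyQuery : (ρ : TGD) → CQ (length (frontierVars ρ))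
bodyQuery ρ = record
  { output = fromList (frontierVars ρ)
  ; conj   = body ρ
  ; safe   = VecAllP.fromList⁺ (All.tabulate λ x∈ →
               ∈-vars⇒occurs (body ρ) (proj₂ (∈-filter⁻ (_∈? vars (body ρ)) {xs = vars (head ρ)} x∈)))
  }

-- Reduction to certain answers over the saturated database

module Reduction (D : Database) (Oʰᵍ O : Ontology)
                 (cert? : ∀ {n} (q : CQ n) D c → Dec (cert q D O c)) where

  O⁺ : Ontology
  O⁺ = Oʰᵍ ++ O

  O⊆O⁺ : O ⊆ O⁺
  O⊆O⁺ = ∈-++⁺ʳ Oʰᵍ

  K : List Const
  K = collect [_] D ++ collect termConsts (concatMap head O⁺)

  Instantiation : Set
  Instantiation = TGD × (Var → Const)

  derived : Instantiation → Database
  derived (ρ , θ) = List.map (mapAtom (ground θ)) (head ρ)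

  -- The first component cannot be taken from the promise: it is used in the proof of
  -- a positive answer, where the promise is irrelevant.
  Derivable : Database → Instantiation → Set₁
  Derivable D′ (ρ , θ) = All (_∈ vars (body ρ)) (vars (head ρ)) ×
                         cert (bodyQuery ρ) D′ O (Vec.map θ (fromList (frontierVars ρ)))

  derivable? : ∀ D′ α → Dec (Derivable D′ α)
  derivable? D′ (ρ , θ) = All.all? (_∈? vars (body ρ)) (vars (head ρ)) ×-dec cert? (bodyQuery ρ) D′ _

  instantiations : TGD → List Instantiation
  instantiations ρ = List.map (ρ ,_) (assignments K (vars (head ρ)))

  candidates : List Instantiation
  candidates = concatMap instantiations Oʰᵍ

  D* : Database
  D* = saturate derivable? derived candidates D

  ∈-candidates⁺ : ∀ {ρ θ} → ρ ∈ Oʰᵍ → θ ∈ assignments K (vars (head ρ)) → (ρ , θ) ∈ candidates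
  ∈-candidates⁺ ρ∈ θ∈ = ∈-concatMap⁺ instantiations (Any.map (λ { refl → ∈-map⁺ _ θ∈ }) ρ∈)

  ∈-candidates⁻ : ∀ {ρ θ} → (ρ , θ) ∈ candidates → ρ ∈ Oʰᵍ × θ ∈ assignments K (vars (head ρ))
  ∈-candidates⁻ α∈ with σ , σ∈ , α∈σ ← find (∈-concatMap⁻ instantiations {xs = Oʰᵍ} α∈)
                   with _ , θ∈ , refl ← ∈-map⁻ (σ ,_) α∈σ = σ∈ , θ∈

  -- Certainty of the body query gives a match in `M` agreeing with `θ` on the frontier. By `safe`
  -- every head variable is in the frontier, so satisfying `ρ` puts exactly the instance under `θ`
  -- into `M`.
  derived-sound : ∀ {ρ θ D′ M} → ρ ∈ Oʰᵍ → Derivable D′ (ρ , θ) →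
                  Model O⁺ M → M ⊇ᴰ D′ → M ⊇ᴰ derived (ρ , θ)
  derived-sound {ρ} {θ} {M = M} ρ∈ (safe , certain) M⊨O⁺ M⊇D′
    with h , bs , e ← certain M M⊇D′ (AllP.++⁻ʳ Oʰᵍ M⊨O⁺)
    with h′ , agree , hs ← All.lookup M⊨O⁺ (∈-++⁺ˡ ρ∈) h bs =
    AllP.map⁺ (All.tabulate λ {a} a∈ →
      subst M (trans (mapAtom-vars-cong (λ _ → refl) h′-ground a∈) (sym (mapAtom-∘ con (ground θ) a)))
              (All.lookup hs a∈))
    where
    h′-ground : ∀ {x} → x ∈ vars (head ρ) → h′ x ≡ con (θ x)
    h′-ground {x} x∈ =
      trans (agree x (∈-vars⇒occurs _ (All.lookup safe x∈) , ∈-vars⇒occurs _ x∈))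
            (map-fromList-injective (trans e (sym (map-∘ con θ _)))
              (∈-filter⁺ (_∈? vars (body ρ)) x∈ (All.lookup safe x∈)))

  sound : ∀ {n} (q : CQ n) {c} → cert q D* O c → cert q D O⁺ c
  sound q certain M M⊇D M⊨O⁺ = certain M
    -- Containment in `M` is an invariant of saturation, so `M` also contains `D*`.
    (saturate-induction derivable? derived {I = M ⊇ᴰ_} candidates
      (λ α∈ d M⊇D′ → AllP.++⁺ (derived-sound {M = M} (proj₁ (∈-candidates⁻ α∈)) d M⊨O⁺ M⊇D′) M⊇D′) M⊇D)
    (AllP.++⁻ʳ Oʰᵍ M⊨O⁺)

  heads-within : HeadConstantsWithin K O⁺
  heads-within σ∈ a∈ j {c} e = ∈-++⁺ʳ (collect [_] D) (∈-collect⁺ termConsts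
    (∈-concatMap⁺ head (Any.map (λ { refl → a∈ }) σ∈)) j
    (subst (λ t → c ∈ termConsts t) (sym e) (here refl)))

  assignments-within : ∀ {θ} xs → θ ∈ assignments K xs → ∀ {x} → x ∈ xs → θ x ∈ K
  assignments-within (y ∷ xs) θ∈ {x} x∈
    with c , θ′ , c∈K , θ′∈ , refl ← ∈-cartesianProductWith⁻ (update y) K (assignments K xs) θ∈
    with x ≟ y | x∈
  ... | yes _  | _         = c∈K
  ... | no x≢y | here x≡y  = contradiction x≡y x≢y
  ... | no _   | there x∈′ = assignments-within xs θ′∈ x∈′

  -- Derived atoms are built from head constants and values in `K`, so saturation does not outgrow
  -- the candidates fixed beforehand.
  D*-within : Within K D*
  D*-within = saturate-induction derivable? derived {I = Within K} candidates
    (λ {α} α∈ _ D′⊆K b∈ → Sum.[ derived-within α α∈ , D′⊆K ]′ (∈-++⁻ (derived α) b∈))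
    λ a∈ j → ∈-++⁺ˡ (∈-collect⁺ [_] a∈ j (here refl))
    where
    derived-within : ∀ α → α ∈ candidates → Within K (derived α)
    derived-within (ρ , θ) α∈ b∈ j
      with ρ∈ , θ∈ ← ∈-candidates⁻ α∈
      with a , a∈ , refl ← ∈-map⁻ (mapAtom (ground θ)) b∈ =
      subst (_∈ K) (sym (lookup-map j (ground θ) (args a))) (ground-within (lookup (args a) j) refl)
      where
      ground-within : ∀ u → lookup (args a) j ≡ u → ground θ u ∈ K
      ground-within (con c) e = heads-within (∈-++⁺ˡ ρ∈) a∈ j e
      ground-within (var x) e = assignments-within (vars (head ρ)) θ∈ (∈-vars⁺ a∈ j e)

  module _ (hg : HeadGround Oʰᵍ O⁺) where

    chase-⊨-head-ground : ∀ {ρ} → ρ ∈ Oʰᵍ → Chase D* O ⊨ ρ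
    chase-⊨-head-ground {ρ} ρ∈ h bs = h , (λ _ _ → refl) , All.tabulate head-in-chase
      where
      harmless : ∀ {x} → x ∈ vars (head ρ) → Harmless O⁺ ρ x
      harmless x∈ = HeadGround.harmless hg ρ∈ (∈-vars⇒occurs (head ρ) x∈)

      constant : ∀ {x} → x ∈ vars (head ρ) → ∃[ c ] c ∈ K × h x ≡ con c
      constant x∈ with c , e ← harmless-constant {D = D*} O⊆O⁺ ρ bs (harmless x∈) =
        c , body-constants D*-within (heads-within ∘ O⊆O⁺) bs (proj₁ (harmless x∈)) e , e

      θ-spec = assignments-complete h (vars (head ρ)) constant

      θ : Var → Const
      θ = proj₁ θ-spec

      derivable : Derivable D* (ρ , θ)
      derivable =
        All.tabulate (λ x∈ → occurs⇒∈-vars (proj₁ (harmless x∈))) ,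
        -- The match `h` lives in the chase of `D*`, so by universality its frontier values are
        -- certain over `D*`.
        chase-universal (bodyQuery ρ) (h , bs ,
          trans (map-fromList-cong (frontierVars ρ) λ x∈ →
                   proj₂ (proj₂ θ-spec) (proj₁ (∈-filter⁻ (_∈? vars (body ρ)) x∈)))
                (map-∘ con θ _))

      head-in-chase : ∀ {a} → a ∈ head ρ → Chase D* O (mapAtom (apply h) a)
      head-in-chase {a} a∈ = subst (Chase D* O)
        (trans (mapAtom-∘ con (ground θ) a)
               (sym (mapAtom-vars-cong (λ _ → refl) (proj₂ (proj₂ θ-spec)) a∈)))
        (fact (saturate-closed derivable? derived candidates
          (∈-candidates⁺ ρ∈ (proj₁ (proj₂ θ-spec))) derivable (∈-map⁺ _ a∈)))

    -- The chase of `D*` is itself a model of both parts that contains `D`, so the tuple is an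
    -- answer there; universality turns this into certainty over `D*` and `O`.
    complete : ∀ {n} (q : CQ n) {c} → cert q D O⁺ c → cert q D* O c
    complete q certain = chase-universal q (certain (Chase D* O)
      (All.tabulate (fact ∘ saturate-⊇ derivable? derived candidates))
      (AllP.++⁺ (All.tabulate chase-⊨-head-ground) chase-model))

mainTheorem5 : {ℓ : Level} (C : Pred Ontology ℓ) →
    Decidable (CERT-EVAL C) → Decidable (DP-CERT-EVAL C)
mainTheorem5 C decide i dyadic = map′ (sound query)
  -- `complete` rests on the promise, so its result is available only irrelevantly; since `cert?`
  -- decides the statement, `recompute` recovers a proof.
  (λ certain → recompute (cert? query D* tuple) (complete (Dyadic.head-ground dyadic) query certain))
  (cert? query D* tuple)
  where
  open DPCertEvalInput i

  cert? : ∀ {n} (q : CQ n) D c → Dec (cert q D Oᶜ c)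
  cert? q D c = decide (record { database = D ; ontology = Oᶜ ; query = q ; tuple = c })
                       (Dyadic.in-class dyadic)

  open Reduction database Oʰᵍ Oᶜ cert?
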